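{- Let $m\ge 1$, $T\subseteq\{0,\ldots,m-1\}$, $\Delta_t=m-t$ for $t\in T$, and let $U=\sum_{t\in T}N^{\Delta_t}$ as a linear operator on $\mathbb{F}_2^m$. If $U=0$, set $r=0$; then $(I+U)^{ -1}=I$, with the empty product understood as $I$. Otherwise, put $\Delta_{\min}=\min\{\Delta_t:t\in T\}$ and $$r=\left\lceil\log_2\frac{m}{\Delta_{\min}}\right\rceil.$$ Then $U^{2^r}=0$ and $$(I+U)^{ -1}=\prod_{k=0}^{r-1}\bigl(I+U^{2^k}\bigr).$$ Moreover, $r$ is the least nonnegative integer for which $U^{2^r}=0$.
   Context: For $d\ge 0$, $N^d$ is the truncated right shift on $\mathbb{F}_2^m$: for $y=(y_0,\ldots,y_{m-1})$, $(N^dy)_i=y_{i+d}$ if $0\le i<m-d$ and $(N^dy)_i=0$ if $m-d\le i<m$; $N^d=0$ for $d\ge m$. Empty sums denote the zero map and $I$ is the identity on $\mathbb{F}_2^m$. -}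

module Defs where

open import Algebra.Bundles.Raw using (RawSemiring)
import Algebra.Definitions.RawSemiring as RawSemiringDefinitions
open import Algebra.Morphism.Definitions using (Homomorphic₁; Homomorphic₂)
open import Data.Bool using (Bool; true; false; _∧_; _xor_; if_then_else_)
import Data.Bool.Properties as Bool
open import Data.Fin using (Fin; toℕ; fromℕ<)
open import Data.Fin.Properties using (toℕ<n)
open import Data.Fin.Subset using (Subset)
open import Data.Fin.Subset.Properties using (_∈?_)
open import Data.Integer as ℤ using (+_)
import Data.Integer.DivMod as ℤ
import Data.Integer.Properties as ℤ
open import Data.List as List using (List; allFin; filter)
open import Data.List.Extrema.Nat using (min; v≤min⁺)
import Data.List.Relation.Unary.All as All
import Data.List.Relation.Unary.All.Properties as All
open import Data.Nat as ℕ using (ℕ; zero; suc; _∸_; NonZero; _<?_; s≤s; z≤n)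
import Data.Nat.Logarithm as ℕ
import Data.Nat.Properties as ℕ
open import Data.Nat.Induction using (<-rec)
open import Data.Product using (_,_)
open import Data.Rational.Unnormalised as ℚᵘ using (ℚᵘ; mkℚᵘ; _/_; ceiling; 1ℚᵘ)
open import Data.Vec using (Vec; []; _∷_; lookup; map; replicate; tabulate; zipWith)
import Data.Vec.Properties as Vec
open import Function using (_∘_; id; _⇔_; mk⇔; Equivalence)
open import Level using (0ℓ)
open import Relation.Binary.PropositionalEquality
open import Relation.Nullary using (Dec; yes; no; does; ¬_)
open import Relation.Nullary.Decidable using (map′; _×-dec_)

-- F₂ is Bool with _xor_ as addition and _∧_ as multiplication
-- (cf. Data.Bool.Properties.xor-∧-commutativeRing).

F₂^ : ℕ → Set
F₂^ = Vec Bool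

infixl 6 _⊕_
infixr 7 _·_

_⊕_ : ∀ {m} → F₂^ m → F₂^ m → F₂^ m
_⊕_ = zipWith _xor_

_·_ : ∀ {m} → Bool → F₂^ m → F₂^ m
c · x = map (c ∧_) x

𝟎 : ∀ {m} → F₂^ m
𝟎 = replicate _ false

record LinearOperator (m : ℕ) : Set where
  field
    ⟦_⟧    : F₂^ m → F₂^ m
    ⊕-homo : Homomorphic₂ (F₂^ m) (F₂^ m) _≡_ ⟦_⟧ _⊕_ _⊕_
    ·-homo : ∀ c → Homomorphic₁ (F₂^ m) (F₂^ m) _≡_ ⟦_⟧ (c ·_) (c ·_)

open LinearOperator public

private
  xor-interchange : ∀ a b c d → (a xor b) xor (c xor d) ≡ (a xor c) xor (b xor d)
  xor-interchange true  true  true  d = refl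
  xor-interchange true  true  false d = sym (Bool.not-involutive d)
  xor-interchange true  false true  d = Bool.not-involutive d
  xor-interchange true  false false d = refl
  xor-interchange false true  true  d = refl
  xor-interchange false true  false d = refl
  xor-interchange false false true  d = refl
  xor-interchange false false false d = refl

  ⊕-interchange : ∀ {m} (u v x y : F₂^ m) → (u ⊕ v) ⊕ (x ⊕ y) ≡ (u ⊕ x) ⊕ (v ⊕ y)
  ⊕-interchange []      []      []      []      = refl
  ⊕-interchange (a ∷ u) (b ∷ v) (c ∷ x) (d ∷ y) =
    cong₂ _∷_ (xor-interchange a b c d) (⊕-interchange u v x y)

  ·-distrib-⊕ : ∀ {m} c (x y : F₂^ m) → c · (x ⊕ y) ≡ (c · x) ⊕ (c · y)
  ·-distrib-⊕ c []      []      = refl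
  ·-distrib-⊕ c (a ∷ x) (b ∷ y) = cong₂ _∷_ (Bool.∧-distribˡ-xor c a b) (·-distrib-⊕ c x y)

  𝟎⊕𝟎 : ∀ m → 𝟎 {m} ⊕ 𝟎 ≡ 𝟎
  𝟎⊕𝟎 zero    = refl
  𝟎⊕𝟎 (suc m) = cong (false ∷_) (𝟎⊕𝟎 m)

  ·-𝟎 : ∀ c m → c · 𝟎 {m} ≡ 𝟎
  ·-𝟎 c zero    = refl
  ·-𝟎 c (suc m) = cong₂ _∷_ (Bool.∧-zeroʳ c) (·-𝟎 c m)

linearOperators : ℕ → RawSemiring 0ℓ 0ℓ
linearOperators m = record
  { Carrier = LinearOperator m
  ; _≈_     = λ A B → ⟦ A ⟧ ≗ ⟦ B ⟧
  ; _+_     = λ A B → record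
      { ⟦_⟧    = λ x → ⟦ A ⟧ x ⊕ ⟦ B ⟧ x
      ; ⊕-homo = λ x y → trans (cong₂ _⊕_ (⊕-homo A x y) (⊕-homo B x y))
                               (⊕-interchange (⟦ A ⟧ x) (⟦ A ⟧ y) (⟦ B ⟧ x) (⟦ B ⟧ y))
      ; ·-homo = λ c x → trans (cong₂ _⊕_ (·-homo A c x) (·-homo B c x))
                               (sym (·-distrib-⊕ c (⟦ A ⟧ x) (⟦ B ⟧ x)))
      }
  ; _*_     = λ A B → record
      { ⟦_⟧    = ⟦ A ⟧ ∘ ⟦ B ⟧
      ; ⊕-homo = λ x y → trans (cong ⟦ A ⟧ (⊕-homo B x y)) (⊕-homo A (⟦ B ⟧ x) (⟦ B ⟧ y))
      ; ·-homo = λ c x → trans (cong ⟦ A ⟧ (·-homo B c x)) (·-homo A c (⟦ B ⟧ x))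
      }
  ; 0#      = record
      { ⟦_⟧    = λ _ → 𝟎
      ; ⊕-homo = λ _ _ → sym (𝟎⊕𝟎 m)
      ; ·-homo = λ c _ → sym (·-𝟎 c m)
      }
  ; 1#      = record { ⟦_⟧ = id ; ⊕-homo = λ _ _ → refl ; ·-homo = λ _ _ → refl }
  }

module _ {m : ℕ} where
  open RawSemiring (linearOperators m) public
    using (_≈_; _+_; _*_) renaming (0# to O; 1# to I)
  open RawSemiringDefinitions (linearOperators m) public
    using (_^_; product)

private
  ∀-vec? : ∀ {m} {P : F₂^ m → Set} → (∀ x → Dec (P x)) → Dec (∀ x → P x)
  ∀-vec? {zero}  P? = map′ (λ { p [] → p }) (λ p → p []) (P? [])
  ∀-vec? {suc m} P? = map′
    (λ { (p , q) (true ∷ x) → p x ; (p , q) (false ∷ x) → q x })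
    (λ p → (λ x → p (true ∷ x)) , (λ x → p (false ∷ x)))
    (∀-vec? (P? ∘ (true ∷_)) ×-dec ∀-vec? (P? ∘ (false ∷_)))

infix 4 _≈?_

_≈?_ : ∀ {m} (A B : LinearOperator m) → Dec (A ≈ B)
A ≈? B = ∀-vec? λ x → Vec.≡-dec Bool._≟_ (⟦ A ⟧ x) (⟦ B ⟧ x)

-- y at k is the coordinate y_k, read as 0 when k lies outside {0,…,m-1}.
infixl 8 _at_

_at_ : ∀ {m} → F₂^ m → ℕ → Bool
_at_ {m} y k with k <? m
... | yes k<m = lookup y (fromℕ< k<m)
... | no  _   = false

private
  at-⊕ : ∀ {m} (x y : F₂^ m) k → (x ⊕ y) at k ≡ (x at k) xor (y at k)
  at-⊕ {m} x y k with k <? m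
  ... | yes k<m = Vec.lookup-zipWith _xor_ (fromℕ< k<m) x y
  ... | no  _   = refl

  at-· : ∀ {m} c (x : F₂^ m) k → (c · x) at k ≡ c ∧ (x at k)
  at-· {m} c x k with k <? m
  ... | yes k<m = Vec.lookup-map (fromℕ< k<m) (c ∧_) x
  ... | no  _   = sym (Bool.∧-zeroʳ c)

  tabulate-⊕ : ∀ {m} (f g : Fin m → Bool) →
               tabulate (λ i → f i xor g i) ≡ tabulate f ⊕ tabulate g
  tabulate-⊕ {zero}  f g = refl
  tabulate-⊕ {suc m} f g = cong ((f Fin.zero xor g Fin.zero) ∷_) (tabulate-⊕ (f ∘ Fin.suc) (g ∘ Fin.suc))

-- The shift N^d for every d at once; the condition i < m - d is i + d < m,
-- so N^ d is the zero map for d ≥ m.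
N^_ : ∀ {m} → ℕ → LinearOperator m
N^ d = record
  { ⟦_⟧    = λ y → tabulate λ i → y at (toℕ i ℕ.+ d)
  ; ⊕-homo = λ x y → trans (Vec.tabulate-cong λ i → at-⊕ x y (toℕ i ℕ.+ d)) (tabulate-⊕ _ _)
  ; ·-homo = λ c x → trans (Vec.tabulate-cong λ i → at-· c x (toℕ i ℕ.+ d))
                           (Vec.tabulate-∘ (c ∧_) (λ i → x at (toℕ i ℕ.+ d)))
  }

Δ : ∀ {m} → Fin m → ℕ
Δ {m} t = m ∸ toℕ t

-- The Δ_t, t ∈ T, each listed once.
Δs : ∀ {m} → Subset m → List ℕ
Δs {m} T = List.map Δ (filter (_∈? T) (allFin m))

U : ∀ {m} → Subset m → LinearOperator m
U T = List.foldr _+_ O (List.map N^_ (Δs T))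

-- For nonempty T this is the minimum of the Δ_t, as each Δ_t ≤ m;
-- the default m only matters for T = ∅, where U T is zero.
Δmin : ∀ {m} → Subset m → ℕ
Δmin {m} T = min m (Δs T)

instance
  Δmin-nonZero : ∀ {m} .{{_ : NonZero m}} {T : Subset m} → NonZero (Δmin T)
  Δmin-nonZero {m} {T} = ℕ.>-nonZero
    (v≤min⁺ (ℕ.>-nonZero⁻¹ m)
      (All.map⁺ (All.universal (λ t → ℕ.m<n⇒0<n∸m (toℕ<n t)) (filter (_∈? T) (allFin m)))))

-- ⌈log₂ x⌉ for rational x ≥ 1, as ⌈log₂ ⌈x⌉ ⌉.  ⌈log₂⌉-spec shows that it is
-- the least k with x ≤ 2^k, i.e. with log₂ x ≤ k.
⌈log₂_⌉ : ℚᵘ → ℕ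
⌈log₂ x ⌉ = ℕ.⌈log₂ ℤ.∣ ceiling x ∣ ⌉

private
  n≤2^⌈log₂n⌉ : ∀ n → n ℕ.≤ 2 ℕ.^ ℕ.⌈log₂ n ⌉
  n≤2^⌈log₂n⌉ = <-rec _ step
    where
    step : ∀ n → (∀ {i} → i ℕ.< n → i ℕ.≤ 2 ℕ.^ ℕ.⌈log₂ i ⌉) → n ℕ.≤ 2 ℕ.^ ℕ.⌈log₂ n ⌉
    step zero            _   = z≤n
    step (suc zero)      _   = s≤s z≤n
    step (suc (suc n))   rec = begin
      N                                ≡⟨ ℕ.⌊n/2⌋+⌈n/2⌉≡n N ⟨
      ℕ.⌊ N /2⌋ ℕ.+ h                  ≤⟨ ℕ.+-monoˡ-≤ h (ℕ.⌊n/2⌋≤⌈n/2⌉ N) ⟩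
      h ℕ.+ h                          ≡⟨ cong (h ℕ.+_) (ℕ.+-identityʳ h) ⟨
      2 ℕ.* h                          ≤⟨ ℕ.*-monoʳ-≤ 2 (rec (ℕ.⌈n/2⌉<n n)) ⟩
      2 ℕ.^ suc ℕ.⌈log₂ h ⌉            ≡⟨ cong (λ k → 2 ℕ.^ suc k) (ℕ.⌈log₂⌈n/2⌉⌉≡⌈log₂n⌉∸1 N) ⟩
      2 ℕ.^ suc (ℕ.⌈log₂ N ⌉ ∸ 1)      ≡⟨ cong (2 ℕ.^_) (ℕ.m+[n∸m]≡n (ℕ.⌈log₂⌉-mono-≤ {2} {N} (s≤s (s≤s z≤n)))) ⟩
      2 ℕ.^ ℕ.⌈log₂ N ⌉                ∎
      where
      open ℕ.≤-Reasoning
      N = suc (suc n)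
      h = ℕ.⌈ N /2⌉

  ⌈log₂⌉-galois : ∀ n k → n ℕ.≤ 2 ℕ.^ k ⇔ ℕ.⌈log₂ n ⌉ ℕ.≤ k
  ⌈log₂⌉-galois n k = mk⇔
    (λ n≤2^k → subst (ℕ.⌈log₂ n ⌉ ℕ.≤_) (ℕ.⌈log₂2^n⌉≡n k) (ℕ.⌈log₂⌉-mono-≤ n≤2^k))
    (λ l≤k → ℕ.≤-trans (n≤2^⌈log₂n⌉ n) (ℕ.^-monoʳ-≤ 2 l≤k))

  ceiling-galois : ∀ n d-1 z → n ℤ.≤ z ℤ.* + suc d-1 ⇔ ceiling (mkℚᵘ n d-1) ℤ.≤ z
  ceiling-galois n d-1 z = mk⇔ to from
    where
    open ℤ.≤-Reasoning
    d = + suc d-1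
    q = (ℤ.- n) ℤ./ d

    q≡ : q ≡ (ℤ.- n) ℤ./ℕ suc d-1
    q≡ = ℤ.div-pos-is-/ℕ (ℤ.- n) (suc d-1)

    to : n ℤ.≤ z ℤ.* d → ℤ.- q ℤ.≤ z
    to n≤zd = subst (ℤ.- q ℤ.≤_) (ℤ.neg-involutive z) (ℤ.neg-mono-≤ -z≤q)
      where
      -z<1+q : ℤ.- z ℤ.< ℤ.suc q
      -z<1+q = ℤ.*-cancelʳ-<-nonNeg d (begin-strict
        ℤ.- z ℤ.* d                              ≡⟨ ℤ.neg-distribˡ-* z d ⟨
        ℤ.- (z ℤ.* d)                            ≤⟨ ℤ.neg-mono-≤ n≤zd ⟩
        ℤ.- n                                    <⟨ ℤ.n<s[n/ℕd]*d (ℤ.- n) (suc d-1) ⟩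
        ℤ.suc ((ℤ.- n) ℤ./ℕ suc d-1) ℤ.* d       ≡⟨ cong (λ p → ℤ.suc p ℤ.* d) q≡ ⟨
        ℤ.suc q ℤ.* d                            ∎)

      -z≤q : ℤ.- z ℤ.≤ q
      -z≤q = subst (ℤ.- z ℤ.≤_) (ℤ.pred-suc q) (ℤ.i<j⇒i≤pred[j] -z<1+q)

    from : ℤ.- q ℤ.≤ z → n ℤ.≤ z ℤ.* d
    from -q≤z = begin
      n                  ≡⟨ ℤ.neg-involutive n ⟨
      ℤ.- (ℤ.- n)        ≤⟨ ℤ.neg-mono-≤ (ℤ.[n/d]*d≤n (ℤ.- n) d) ⟩
      ℤ.- (q ℤ.* d)      ≡⟨ ℤ.neg-distribˡ-* q d ⟩
      ℤ.- q ℤ.* d        ≤⟨ ℤ.*-monoʳ-≤-nonNeg d -q≤z ⟩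
      z ℤ.* d            ∎

⌈log₂⌉-spec : ∀ x → 1ℚᵘ ℚᵘ.≤ x → ∀ k → x ℚᵘ.≤ + (2 ℕ.^ k) / 1 ⇔ ⌈log₂ x ⌉ ℕ.≤ k
⌈log₂⌉-spec (mkℚᵘ n d-1) (ℚᵘ.*≤* 1≤x) k = mk⇔
  (λ { (ℚᵘ.*≤* x≤2^k) → L.to (ℤ.drop‿+≤+ (subst (ℤ._≤ + (2 ℕ.^ k)) (sym +∣c∣≡c)
         (C.to (subst (ℤ._≤ _) (ℤ.*-identityʳ n) x≤2^k)))) })
  (λ l≤k → ℚᵘ.*≤* (subst (ℤ._≤ _) (sym (ℤ.*-identityʳ n))
         (C.from (subst (ℤ._≤ + (2 ℕ.^ k)) +∣c∣≡c (ℤ.+≤+ (L.from l≤k))))))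
  where
  c = ceiling (mkℚᵘ n d-1)
  module C = Equivalence (ceiling-galois n d-1 (+ (2 ℕ.^ k)))
  module L = Equivalence (⌈log₂⌉-galois ℤ.∣ c ∣ k)

  d≤n : + suc d-1 ℤ.≤ n
  d≤n = subst₂ ℤ._≤_ (ℤ.*-identityˡ (+ suc d-1)) (ℤ.*-identityʳ n) 1≤x

  c≰0 : ¬ (c ℤ.≤ + 0)
  c≰0 c≤0 = ℤ.≤⇒≯ (ℤ.≤-trans d≤n (Equivalence.from (ceiling-galois n d-1 (+ 0)) c≤0)) (ℤ.+<+ (s≤s z≤n))

  +∣c∣≡c : + ℤ.∣ c ∣ ≡ c
  +∣c∣≡c = ℤ.0≤i⇒+∣i∣≡i (ℤ.<⇒≤ (ℤ.≰⇒> c≰0))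

r : ∀ {m} .{{_ : NonZero m}} → Subset m → ℕ
r {m} T = if does (U T ≈? O) then 0 else ⌈log₂ + m / Δmin T ⌉

{-# OPTIONS --safe #-}
module Submission where

-- In characteristic 2, (I + A)(I + A) = I + A², so multiplying I + U by the
-- product telescopes it to I + U^(2^r).  For the exponent: if y vanishes from
-- index b on, then U y vanishes from b - Δmin on, and the coordinate of U y at
-- b - Δmin - 1 is the one of y at b - 1, since all other shifts in U are
-- larger than Δmin and the Δ_t are distinct.  Hence U^n = 0 iff m ≤ n Δmin.

open import Defs
open import Data.Bool using (Bool; true; false; _xor_)
import Data.Bool.Properties as Bool
open import Data.Fin using (Fin; toℕ; fromℕ<)
open import Data.Fin.Properties using (toℕ<n; toℕ-injective; toℕ-fromℕ<; fromℕ<-toℕ)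
open import Data.Fin.Subset using (Subset)
open import Data.Fin.Subset.Properties using (_∈?_)
open import Data.Integer as ℤ using (+_)
import Data.Integer.Properties as ℤ
open import Data.List as List using (List; []; _∷_; filter; allFin)
open import Data.List.Extrema.Nat using (min; min≤⊤; min≤xs; argmin-sel)
open import Data.List.Membership.Propositional using (_∈_)
open import Data.List.Relation.Unary.All as All using (All; []; _∷_)
import Data.List.Relation.Unary.All.Properties as All
open import Data.List.Relation.Unary.AllPairs using (_∷_)
open import Data.List.Relation.Unary.Any using (here; there)
open import Data.List.Relation.Unary.Unique.Propositional using (Unique)
import Data.List.Relation.Unary.Unique.Propositional.Properties as Unique
open import Data.Nat as ℕ using (ℕ; zero; suc; _≤_; _<_; _∸_; NonZero; _≡ᵇ_)
import Data.Nat.Properties as ℕ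
open import Data.Product using (_×_; _,_)
open import Data.Rational.Unnormalised as ℚᵘ using (1ℚᵘ; _/_)
open import Data.Sum using (inj₁; inj₂)
open import Data.Vec using ([]; _∷_; lookup; tabulate)
import Data.Vec.Properties as Vec
open import Function using (_∘_; id; case_of_; _⇔_; mk⇔; Equivalence)
open import Function.Construct.Composition using (_⇔-∘_)
open import Function.Consequences.Propositional
  using (strictlyInverseˡ⇒inverseˡ; strictlyInverseʳ⇒inverseʳ)
open import Function.Definitions using (Inverseᵇ)
open import Relation.Binary.PropositionalEquality
open import Relation.Nullary using (¬_; yes; no; contradiction)
open import Relation.Nullary.Decidable using (dec-true; dec-false)

-- Products of the operators I + A

⊕-identityʳ : ∀ {m} (x : F₂^ m) → x ⊕ 𝟎 ≡ x
⊕-identityʳ = Vec.zipWith-identityʳ Bool.xor-identityʳ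

xor-cancel-middle : ∀ a b c → (a xor b) xor (b xor c) ≡ a xor c
xor-cancel-middle a b c = begin
  (a xor b) xor (b xor c)  ≡⟨ Bool.xor-assoc a b (b xor c) ⟩
  a xor (b xor (b xor c))  ≡⟨ cong (a xor_) (Bool.xor-assoc b b c) ⟨
  a xor ((b xor b) xor c)  ≡⟨ cong (λ z → a xor (z xor c)) (Bool.xor-same b) ⟩
  a xor c                  ∎
  where open ≡-Reasoning

⊕-cancel-middle : ∀ {m} (x y z : F₂^ m) → (x ⊕ y) ⊕ (y ⊕ z) ≡ x ⊕ z
⊕-cancel-middle []      []      []      = refl
⊕-cancel-middle (a ∷ x) (b ∷ y) (c ∷ z) =
  cong₂ _∷_ (xor-cancel-middle a b c) (⊕-cancel-middle x y z)

I+A-square : ∀ {m} (A : LinearOperator m) → (I + A) * (I + A) ≈ I + A * A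
I+A-square A x = begin
  (x ⊕ ⟦ A ⟧ x) ⊕ ⟦ A ⟧ (x ⊕ ⟦ A ⟧ x)            ≡⟨ cong ((x ⊕ ⟦ A ⟧ x) ⊕_) (⊕-homo A x (⟦ A ⟧ x)) ⟩
  (x ⊕ ⟦ A ⟧ x) ⊕ (⟦ A ⟧ x ⊕ ⟦ A ⟧ (⟦ A ⟧ x))    ≡⟨ ⊕-cancel-middle x (⟦ A ⟧ x) _ ⟩
  x ⊕ ⟦ A ⟧ (⟦ A ⟧ x)                            ∎
  where open ≡-Reasoning

^-+-homo : ∀ {m} (A : LinearOperator m) p q → A ^ (p ℕ.+ q) ≈ A ^ p * A ^ q
^-+-homo A zero    q x = refl
^-+-homo A (suc p) q x = cong ⟦ A ⟧ (^-+-homo A p q x)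

^-zero : ∀ {m} {A : LinearOperator m} → A ≈ O → ∀ n .{{_ : NonZero n}} → A ^ n ≈ O
^-zero {A = A} A≈O (suc n) x = A≈O (⟦ A ^ n ⟧ x)

^-2^-square : ∀ {m} (A : LinearOperator m) k →
              A ^ (2 ℕ.^ suc k) ≈ A ^ (2 ℕ.^ k) * A ^ (2 ℕ.^ k)
^-2^-square A k x = trans
  (cong (λ n → ⟦ A ^ (2 ℕ.^ k ℕ.+ n) ⟧ x) (ℕ.+-identityʳ (2 ℕ.^ k)))
  (^-+-homo A (2 ℕ.^ k) (2 ℕ.^ k) x)

-- Stated for any sequence of successive squares, so that the induction can pass to `A ∘ suc`. The
-- extra factor `I + A 0` meets the same factor at the head of the product; their square is
-- `I + A 1`, the extra factor for the shifted sequence.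
product-telescopes : ∀ {m} (A : ℕ → LinearOperator m) → (∀ k → A (suc k) ≈ A k * A k) →
                     ∀ n → (I + A 0) * product {n = n} (λ k → I + A (toℕ k)) ≈ I + A n
product-telescopes A square zero    x = refl
product-telescopes A square (suc n) x = begin
  ⟦ (I + A 0) * (I + A 0) ⟧ y  ≡⟨ I+A-square (A 0) y ⟩
  ⟦ I + A 0 * A 0 ⟧ y          ≡⟨ cong (y ⊕_) (square 0 y) ⟨
  ⟦ I + A 1 ⟧ y                ≡⟨ product-telescopes (A ∘ suc) (square ∘ suc) n x ⟩
  ⟦ I + A (suc n) ⟧ x          ∎
  where
  open ≡-Reasoning
  y = ⟦ product {n = n} (λ k → I + A (suc (toℕ k))) ⟧ x

^-commutes : ∀ {m} {A B : LinearOperator m} → A * B ≈ B * A → ∀ n → A ^ n * B ≈ B * A ^ n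
^-commutes             AB≈BA zero    x = refl
^-commutes {A = A} {B} AB≈BA (suc n) x =
  trans (cong ⟦ A ⟧ (^-commutes {A = A} {B} AB≈BA n x)) (AB≈BA (⟦ A ^ n ⟧ x))

I+-commutes : ∀ {m} {A B : LinearOperator m} → A * B ≈ B * A → (I + A) * B ≈ B * (I + A)
I+-commutes {A = A} {B} AB≈BA x =
  trans (cong (⟦ B ⟧ x ⊕_) (AB≈BA x)) (sym (⊕-homo B x (⟦ A ⟧ x)))

product-commutes : ∀ {m n} {f : Fin n → LinearOperator m} {B} →
                   (∀ k → f k * B ≈ B * f k) → product f * B ≈ B * product f
product-commutes {n = zero}              fB≈Bf x = refl
product-commutes {n = suc n} {f} {B} fB≈Bf x = trans
  (cong ⟦ f Fin.zero ⟧ (product-commutes {f = f ∘ Fin.suc} {B} (fB≈Bf ∘ Fin.suc) x))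
  (fB≈Bf Fin.zero _)

nilpotent⇒inverse : ∀ {m} (A : LinearOperator m) n → A ^ (2 ℕ.^ n) ≈ O →
  Inverseᵇ _≡_ _≡_ ⟦ I + A ⟧ ⟦ product {n = n} (λ k → I + A ^ (2 ℕ.^ toℕ k)) ⟧
nilpotent⇒inverse A n A^2^n≈O =
  strictlyInverseˡ⇒inverseˡ ⟦ I + A ⟧ I+A*P , strictlyInverseʳ⇒inverseʳ ⟦ I + A ⟧ P*I+A
  where
  P = product {n = n} (λ k → I + A ^ (2 ℕ.^ toℕ k))

  I+A*P : (I + A) * P ≈ I
  I+A*P x = begin
    -- The sequence starts at `A ^ (2 ℕ.^ 0)`, which acts as `A` by computation.
    ⟦ (I + A) * P ⟧ x        ≡⟨ product-telescopes (λ k → A ^ (2 ℕ.^ k)) (^-2^-square A) n x ⟩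
    x ⊕ ⟦ A ^ (2 ℕ.^ n) ⟧ x  ≡⟨ cong (x ⊕_) (A^2^n≈O x) ⟩
    x ⊕ 𝟎                    ≡⟨ ⊕-identityʳ x ⟩
    x                        ∎
    where open ≡-Reasoning

  A-commutes : A * (I + A) ≈ (I + A) * A
  A-commutes x = sym (I+-commutes {A = A} {A} (λ _ → refl) x)

  -- Telescoping gives a right inverse. Every factor of `P` is a polynomial in `A`, so `P` commutes
  -- with `I + A` and is a left inverse too.
  P*I+A : P * (I + A) ≈ I
  P*I+A x = trans
    (product-commutes {n = n} {λ k → I + A ^ (2 ℕ.^ toℕ k)} {I + A}
      (λ k → I+-commutes {A = A ^ (2 ℕ.^ toℕ k)} {I + A}
        (^-commutes {A = A} {I + A} A-commutes (2 ℕ.^ toℕ k))) x)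
    (I+A*P x)

-- Coordinates

module _ {m : ℕ} where

  at-≥ : ∀ (y : F₂^ m) {k} → m ≤ k → y at k ≡ false
  at-≥ y {k} m≤k with k ℕ.<? m
  ... | yes k<m = contradiction m≤k (ℕ.<⇒≱ k<m)
  ... | no  _   = refl

  at-𝟎 : ∀ k → 𝟎 {m} at k ≡ false
  at-𝟎 k with k ℕ.<? m
  ... | yes k<m = Vec.lookup-replicate (fromℕ< k<m) false
  ... | no  _   = refl

  at-⊕ : ∀ (x y : F₂^ m) k → (x ⊕ y) at k ≡ (x at k) xor (y at k)
  at-⊕ x y k with k ℕ.<? m
  ... | yes k<m = Vec.lookup-zipWith _xor_ (fromℕ< k<m) x y
  ... | no  _   = refl

  at-tabulate : ∀ (f : ℕ → Bool) {k} → k < m → tabulate {n = m} (f ∘ toℕ) at k ≡ f k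
  at-tabulate f {k} k<m with k ℕ.<? m
  ... | yes p = trans (Vec.lookup∘tabulate (f ∘ toℕ) (fromℕ< p)) (cong f (toℕ-fromℕ< p))
  ... | no ¬p = contradiction k<m ¬p

  at-toℕ : ∀ (y : F₂^ m) i → y at toℕ i ≡ lookup y i
  at-toℕ y i with toℕ i ℕ.<? m
  ... | yes p = cong (lookup y) (fromℕ<-toℕ i p)
  ... | no ¬p = contradiction (toℕ<n i) ¬p

  at-ext : ∀ {x y : F₂^ m} → (∀ k → x at k ≡ y at k) → x ≡ y
  at-ext {x} {y} eq = begin
    x                    ≡⟨ Vec.tabulate∘lookup x ⟨
    tabulate (lookup x)  ≡⟨ Vec.tabulate-cong (λ i → trans (sym (at-toℕ x i)) (trans (eq (toℕ i)) (at-toℕ y i))) ⟩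
    tabulate (lookup y)  ≡⟨ Vec.tabulate∘lookup y ⟩
    y                    ∎
    where open ≡-Reasoning

  -- Because coordinates outside the range read as 0, this holds at every `k`: for `m ≤ k` both
  -- sides are `false`.
  N-at : ∀ d (y : F₂^ m) k → ⟦ N^ d ⟧ y at k ≡ y at (k ℕ.+ d)
  N-at d y k with k ℕ.<? m
  ... | yes k<m = trans (Vec.lookup∘tabulate _ (fromℕ< k<m))
                        (cong (λ j → y at (j ℕ.+ d)) (toℕ-fromℕ< k<m))
  ... | no  k≮m = sym (at-≥ y (ℕ.m≤n⇒m≤n+o d (ℕ.≮⇒≥ k≮m)))

-- With `y` read as the polynomial with coefficients `y at k`, its degree is below `b`; `N^ d`
-- divides by the `d`-th power of the variable and drops the remainder.
VanishesFrom : ∀ {m} → ℕ → F₂^ m → Set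
VanishesFrom b y = ∀ k → b ≤ k → y at k ≡ false

basis : ∀ {m} → ℕ → F₂^ m
basis q = tabulate (λ i → toℕ i ≡ᵇ q)

≡ᵇ-refl : ∀ n → (n ≡ᵇ n) ≡ true
≡ᵇ-refl zero    = refl
≡ᵇ-refl (suc n) = ≡ᵇ-refl n

<⇒≢ᵇ : ∀ {m n} → m < n → (n ≡ᵇ m) ≡ false
<⇒≢ᵇ {zero}  (ℕ.s≤s _)   = refl
<⇒≢ᵇ {suc m} (ℕ.s≤s m<n) = <⇒≢ᵇ m<n

basis-at : ∀ {m q} → q < m → basis {m} q at q ≡ true
basis-at {m} {q} q<m = trans (at-tabulate (_≡ᵇ q) q<m) (≡ᵇ-refl q)

basis-vanishes : ∀ {m} q → VanishesFrom (suc q) (basis {m} q)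
basis-vanishes {m} q k q<k with ℕ.<-≤-connex k m
... | inj₁ k<m = trans (at-tabulate (_≡ᵇ q) k<m) (<⇒≢ᵇ q<k)
... | inj₂ m≤k = at-≥ (basis q) m≤k

-- Sums of shifts

-- `U T` is `ΣN (Δs T)` by definition. A general list shows that nilpotency is governed by the
-- distinctness of the distances and their least element `δ`.
ΣN : ∀ {m} → List ℕ → LinearOperator m
ΣN ds = List.foldr _+_ O (List.map N^_ ds)

module _ {m : ℕ} where

  ΣN-at-∷ : ∀ d ds (y : F₂^ m) k → ⟦ ΣN (d ∷ ds) ⟧ y at k ≡ (y at (k ℕ.+ d)) xor (⟦ ΣN ds ⟧ y at k)
  ΣN-at-∷ d ds y k = trans (at-⊕ (⟦ N^ d ⟧ y) (⟦ ΣN ds ⟧ y) k)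
                           (cong (_xor (⟦ ΣN ds ⟧ y at k)) (N-at d y k))

  ΣN-at-false : ∀ {ds} {y : F₂^ m} {k} → All (λ d → y at (k ℕ.+ d) ≡ false) ds →
                ⟦ ΣN ds ⟧ y at k ≡ false
  ΣN-at-false {[]}     {y} {k} []       = at-𝟎 {m} k
  ΣN-at-false {d ∷ ds} {y} {k} (p ∷ ps) =
    trans (ΣN-at-∷ d ds y k) (cong₂ _xor_ p (ΣN-at-false {ds} {y} ps))

  ΣN-vanishes : ∀ {ds δ b} {y : F₂^ m} → All (δ ≤_) ds → VanishesFrom b y →
                VanishesFrom (b ∸ δ) (⟦ ΣN ds ⟧ y)
  ΣN-vanishes {ds} {δ} {b} {y} δ≤ds y-vanishes k b∸δ≤k = ΣN-at-false {ds} {y} (All.map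
    (λ {d} δ≤d → y-vanishes (k ℕ.+ d) (b≤k+d δ≤d)) δ≤ds)
    where
    b≤k+d : ∀ {d} → δ ≤ d → b ≤ k ℕ.+ d
    b≤k+d {d} δ≤d = begin
      b                ≤⟨ ℕ.m≤n+m∸n b δ ⟩
      δ ℕ.+ (b ∸ δ)    ≤⟨ ℕ.+-mono-≤ δ≤d b∸δ≤k ⟩
      d ℕ.+ k          ≡⟨ ℕ.+-comm d k ⟩
      k ℕ.+ d          ∎
      where open ℕ.≤-Reasoning

  -- Index `p ℕ.+ δ` is the last at which `y` can be nonzero. The shift by `d` reads `y` at
  -- `p ℕ.+ d`, which lies beyond it unless `d` is `δ`. Uniqueness makes `δ` occur once; two copies
  -- would cancel over F₂.
  ΣN-leading : ∀ {ds δ p} {y : F₂^ m} → All (δ ≤_) ds → Unique ds → δ ∈ ds →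
               VanishesFrom (suc (p ℕ.+ δ)) y → ⟦ ΣN ds ⟧ y at p ≡ y at (p ℕ.+ δ)
  ΣN-leading {δ ∷ ds} {.δ} {p} {y} (_ ∷ δ≤ds) (δ∉ds ∷ _) (here refl) y-vanishes = begin
    ⟦ ΣN (δ ∷ ds) ⟧ y at p                      ≡⟨ ΣN-at-∷ δ ds y p ⟩
    (y at (p ℕ.+ δ)) xor (⟦ ΣN ds ⟧ y at p)     ≡⟨ cong ((y at (p ℕ.+ δ)) xor_) (ΣN-at-false {ds} {y} (All.map
      (λ {d} (δ≤d , δ≢d) → y-vanishes (p ℕ.+ d) (ℕ.+-monoʳ-< p (ℕ.≤∧≢⇒< δ≤d δ≢d))) (All.zip (δ≤ds , δ∉ds)))) ⟩
    (y at (p ℕ.+ δ)) xor false                  ≡⟨ Bool.xor-identityʳ _ ⟩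
    y at (p ℕ.+ δ)                              ∎
    where open ≡-Reasoning
  ΣN-leading {d ∷ ds} {δ} {p} {y} (δ≤d ∷ δ≤ds) (d∉ds ∷ uniq) (there δ∈ds) y-vanishes =
    trans (ΣN-at-∷ d ds y p)
      (cong₂ _xor_ (y-vanishes (p ℕ.+ d) (ℕ.+-monoʳ-< p (ℕ.≤∧≢⇒< δ≤d (≢-sym (All.lookup d∉ds δ∈ds)))))
                   (ΣN-leading δ≤ds uniq δ∈ds y-vanishes))

  ΣN^-vanishes : ∀ {ds δ b} {y : F₂^ m} → All (δ ≤_) ds → VanishesFrom b y →
                 ∀ n → VanishesFrom (b ∸ n ℕ.* δ) (⟦ ΣN ds ^ n ⟧ y)
  ΣN^-vanishes                    δ≤ds y-vanishes zero    = y-vanishes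
  ΣN^-vanishes {ds} {δ} {b} {y} δ≤ds y-vanishes (suc n) =
    subst (λ c → VanishesFrom c (⟦ ΣN ds ^ suc n ⟧ y)) b∸nδ∸δ
      (ΣN-vanishes δ≤ds (ΣN^-vanishes δ≤ds y-vanishes n))
    where
    b∸nδ∸δ : b ∸ n ℕ.* δ ∸ δ ≡ b ∸ suc n ℕ.* δ
    b∸nδ∸δ = trans (ℕ.∸-+-assoc b (n ℕ.* δ) δ) (cong (b ∸_) (ℕ.+-comm (n ℕ.* δ) δ))

  ΣN^-leading : ∀ {ds δ} {y : F₂^ m} → All (δ ≤_) ds → Unique ds → δ ∈ ds →
                ∀ n p → VanishesFrom (suc (p ℕ.+ n ℕ.* δ)) y →
                ⟦ ΣN ds ^ n ⟧ y at p ≡ y at (p ℕ.+ n ℕ.* δ)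
  ΣN^-leading {y = y} δ≤ds uniq δ∈ds zero p y-vanishes = cong (y at_) (sym (ℕ.+-identityʳ p))
  ΣN^-leading {ds} {δ} {y} δ≤ds uniq δ∈ds (suc n) p y-vanishes = begin
    -- The first `n` applications lower the bound on the support by `n ℕ.* δ` to `suc (p ℕ.+ δ)`,
    -- exactly what the outermost one requires.
    ⟦ ΣN ds ^ suc n ⟧ y at p        ≡⟨ ΣN-leading δ≤ds uniq δ∈ds
                                         (subst (λ c → VanishesFrom c (⟦ ΣN ds ^ n ⟧ y))
                                           (ℕ.m+n∸n≡m (suc (p ℕ.+ δ)) (n ℕ.* δ))
                                           (ΣN^-vanishes δ≤ds y-vanishes′ n)) ⟩
    ⟦ ΣN ds ^ n ⟧ y at (p ℕ.+ δ)    ≡⟨ ΣN^-leading δ≤ds uniq δ∈ds n (p ℕ.+ δ) y-vanishes′ ⟩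
    y at (p ℕ.+ δ ℕ.+ n ℕ.* δ)      ≡⟨ cong (y at_) (ℕ.+-assoc p δ (n ℕ.* δ)) ⟩
    y at (p ℕ.+ suc n ℕ.* δ)        ∎
    where
    open ≡-Reasoning
    y-vanishes′ : VanishesFrom (suc (p ℕ.+ δ ℕ.+ n ℕ.* δ)) y
    y-vanishes′ = subst (λ c → VanishesFrom (suc c) y) (sym (ℕ.+-assoc p δ (n ℕ.* δ))) y-vanishes

  -- If `n ℕ.* δ < m`, the basis vector at `n ℕ.* δ` survives: its nonzero coordinate is carried to
  -- index 0. Conversely, every vector vanishes from `m`, so when `m ≤ n ℕ.* δ` its image vanishes
  -- from index 0.
  ΣN^≈O⇔ : ∀ {ds δ} → All (δ ≤_) ds → Unique ds → δ ∈ ds →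
           ∀ n → ΣN {m} ds ^ n ≈ O ⇔ m ≤ n ℕ.* δ
  ΣN^≈O⇔ {ds} {δ} δ≤ds uniq δ∈ds n = mk⇔ to from
    where
    to : ΣN {m} ds ^ n ≈ O → m ≤ n ℕ.* δ
    to ΣN^n≈O = ℕ.≮⇒≥ λ nδ<m → contradiction
      (begin
        true                  ≡⟨ basis-at nδ<m ⟨
        e at (n ℕ.* δ)        ≡⟨ ΣN^-leading δ≤ds uniq δ∈ds n 0 (basis-vanishes {m} (n ℕ.* δ)) ⟨
        ⟦ ΣN ds ^ n ⟧ e at 0  ≡⟨ cong (_at 0) (ΣN^n≈O e) ⟩
        𝟎 {m} at 0            ≡⟨ at-𝟎 {m} 0 ⟩
        false                 ∎)
      λ ()
      where
      open ≡-Reasoning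
      e = basis {m} (n ℕ.* δ)

    from : m ≤ n ℕ.* δ → ΣN {m} ds ^ n ≈ O
    from m≤nδ y = at-ext λ k → trans
      (ΣN^-vanishes δ≤ds (λ _ → at-≥ y) n k
        (subst (_≤ k) (sym (ℕ.m≤n⇒m∸n≡0 m≤nδ)) ℕ.z≤n))
      (sym (at-𝟎 {m} k))

-- The shift distances Δ_t

Δs≤m : ∀ {m} (T : Subset m) → All (_≤ m) (Δs T)
Δs≤m {m} T = All.map⁺ (All.universal (λ t → ℕ.m∸n≤m m (toℕ t)) (filter (_∈? T) (allFin m)))

Δ-injective : ∀ {m} {s t : Fin m} → Δ s ≡ Δ t → s ≡ t
Δ-injective {s = s} {t} = toℕ-injective ∘ ℕ.∸-cancelˡ-≡ (ℕ.<⇒≤ (toℕ<n s)) (ℕ.<⇒≤ (toℕ<n t))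

Δs-unique : ∀ {m} (T : Subset m) → Unique (Δs T)
Δs-unique {m} T = Unique.map⁺ Δ-injective (Unique.filter⁺ (_∈? T) (Unique.allFin⁺ m))

min-∈ : ∀ {v x xs} → All (_≤ v) (x ∷ xs) → min v (x ∷ xs) ∈ x ∷ xs
min-∈ {v} {x} {xs} (x≤v ∷ _) with argmin-sel id v (x ∷ xs)
... | inj₂ min∈ = min∈
-- The selected value may be the default `v`. It is then a lower bound of the list as well as an
-- upper one, so the head equals it. This matters when 0 is the only element of `T`: its distance is
-- `m` itself.
... | inj₁ min≡v = here (trans min≡v
  (ℕ.≤-antisym (subst (_≤ x) min≡v (All.head (min≤xs v (x ∷ xs)))) x≤v))

Δmin-∈ : ∀ {m} (T : Subset m) → ¬ U T ≈ O → Δmin T ∈ Δs T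
Δmin-∈ T U≉O with Δs T | Δs≤m T
-- With no distances the sum computes to `O`, against `U≉O`; this excludes the case in which
-- `Δmin T` is merely the default `m`.
... | []     | _    = contradiction (λ _ → refl) U≉O
... | d ∷ ds | ds≤m = min-∈ ds≤m

U^≈O⇔ : ∀ {m} (T : Subset m) → ¬ U T ≈ O → ∀ n → U T ^ n ≈ O ⇔ m ≤ n ℕ.* Δmin T
U^≈O⇔ {m} T U≉O = ΣN^≈O⇔ (min≤xs m (Δs T)) (Δs-unique T) (Δmin-∈ T U≉O)

-- The exponent r

-- Cross-multiplication turns the left side into a bound on the fraction `+ m / d`, and `d ≤ m`
-- places that fraction in the range `1 ≤ x` where `⌈log₂⌉-spec` applies.
⌈log₂m/d⌉-spec : ∀ {m} d .{{_ : NonZero d}} → d ≤ m →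
                 ∀ k → m ≤ 2 ℕ.^ k ℕ.* d ⇔ ⌈log₂ + m / d ⌉ ≤ k
⌈log₂m/d⌉-spec {m} d@(suc _) d≤m k =
  ⌈log₂⌉-spec (+ m / d) 1≤m/d k ⇔-∘ mk⇔ to from
  where
  2^k*d = ℤ.pos-* (2 ℕ.^ k) d

  1≤m/d : 1ℚᵘ ℚᵘ.≤ + m / d
  1≤m/d = ℚᵘ.*≤* (subst₂ ℤ._≤_ (sym (ℤ.*-identityˡ (+ d))) (sym (ℤ.*-identityʳ (+ m))) (ℤ.+≤+ d≤m))

  to : m ≤ 2 ℕ.^ k ℕ.* d → + m / d ℚᵘ.≤ + (2 ℕ.^ k) / 1
  to le = ℚᵘ.*≤* (subst₂ ℤ._≤_ (sym (ℤ.*-identityʳ (+ m))) 2^k*d (ℤ.+≤+ le))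

  from : + m / d ℚᵘ.≤ + (2 ℕ.^ k) / 1 → m ≤ 2 ℕ.^ k ℕ.* d
  from (ℚᵘ.*≤* le) = ℤ.drop‿+≤+ (subst₂ ℤ._≤_ (ℤ.*-identityʳ (+ m)) (sym 2^k*d) le)

module _ {m : ℕ} .{{_ : NonZero m}} (T : Subset m) where

  r-zero : U T ≈ O → r T ≡ 0
  r-zero U≈O rewrite dec-true (U T ≈? O) U≈O = refl

  r-log : ¬ U T ≈ O → r T ≡ ⌈log₂ + m / Δmin T ⌉
  r-log U≉O rewrite dec-false (U T ≈? O) U≉O = refl

  -- One equivalence yields both claims about `r T`: at `s = r T` it gives nilpotency, and read from
  -- left to right it gives minimality.
  U^2^≈O⇔r≤ : ∀ s → U T ^ (2 ℕ.^ s) ≈ O ⇔ r T ≤ s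
  U^2^≈O⇔r≤ s = case U T ≈? O of λ where
    (yes U≈O) → mk⇔ (λ _ → subst (_≤ s) (sym (r-zero U≈O)) ℕ.z≤n)
                    -- The exponent must be positive here, since the zeroth power is `I`.
                    (λ _ → ^-zero {A = U T} U≈O (2 ℕ.^ s) {{ℕ.m^n≢0 2 s}})
    (no  U≉O) → subst (λ ρ → U T ^ (2 ℕ.^ s) ≈ O ⇔ ρ ≤ s) (sym (r-log U≉O))
      (⌈log₂m/d⌉-spec (Δmin T) {{Δmin-nonZero {T = T}}} (min≤⊤ m (Δs T)) s ⇔-∘ U^≈O⇔ T U≉O (2 ℕ.^ s))

theorem3p3 : ∀ (m : ℕ) .{{_ : NonZero m}} (T : Subset m) →
    (U T ≈ O → r T ≡ 0 × Inverseᵇ _≡_ _≡_ ⟦ I + U T ⟧ ⟦ I {m} ⟧)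
    × U T ^ (2 ℕ.^ r T) ≈ O
    × Inverseᵇ _≡_ _≡_ ⟦ I + U T ⟧ ⟦ product {n = r T} (λ k → I + U T ^ (2 ℕ.^ toℕ k)) ⟧
    × (∀ s → U T ^ (2 ℕ.^ s) ≈ O → r T ℕ.≤ s)
theorem3p3 m T =
    -- At `n = 0` the product is empty, hence `I`, and `U T ^ 1` acts as `U T`, so `U≈O` serves as
    -- the nilpotency hypothesis.
    (λ U≈O → r-zero T U≈O , nilpotent⇒inverse (U T) 0 U≈O)
  , U^2^r≈O
  , nilpotent⇒inverse (U T) (r T) U^2^r≈O
  , (λ s → Equivalence.to (U^2^≈O⇔r≤ T s))
  where
  U^2^r≈O = Equivalence.from (U^2^≈O⇔r≤ T (r T)) ℕ.≤-refl
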